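{- Let $p\geq 5$ be prime and let $\mathcal{F}$ be a system of linear equations over $\mathbb{F}_p$ in variables $x_1,\dots,x_n$ with no solution in $\{0,1\}^n$. If there exists a Delayer strategy guaranteeing selection of $h$ branching points in the LinTrees$^{(p)}$ Prover–Delayer game on $\mathcal{F}$, then there exists a Delayer strategy guaranteeing selection of $h$ branching points in the tree-like Res(lin$_{\mathbb{F}_p}$) Prover–Delayer game on $\mathcal{F}$.
   Context: For a linear form $f$, $f(\{0,1\}^n)\subseteq\mathbb{F}_p$ is its set of values on Boolean assignments. LinTrees$^{(p)}$ game on $\mathcal{F}$: a position is a set $\mathcal{H}$ of linear equations; it starts with $\mathcal{H}=\mathcal{F}$. In each round Prover chooses a linear form $f$; Delayer either chooses $a\in f(\{0,1\}^n)$ and $f=a$ is added to $\mathcal{H}$, or declares a branching point and chooses $a_1\neq a_2\in f(\{0,1\}^n)$, after which Prover chooses which of $f=a_1$, $f=a_2$ is added. The game ends when $\mathcal{H}$ has no solution in $\mathbb{F}_p^n$. Tree-like Res(lin$_{\mathbb{F}_p}$) game on $\mathcal{F}$: a position is a set $\mathcal{H}_{\neq}$ of linear inequalities $h\neq c$ ($h$ a linear polynomial, $c\in\mathbb{F}_p$); it starts with $\mathcal{H}_{\neq}=\{0\neq a: a\in\mathbb{F}_p, a\neq 0\}$. In each round Prover chooses an inequality $h\neq c\in\mathcal{H}_{\neq}$ and inequalities $f\neq a$, $g\neq b$ with $(f-a)+(g-b)\equiv h-c$; Delayer either chooses one of $f\neq a$, $g\neq b$ to be added to $\mathcal{H}_{\neq}$,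 or declares a branching point, in which case Prover chooses which of them is added. The game ends when $\mathcal{H}_{\neq}$ contains both $x\neq 0$ and $x\neq 1$ for some variable $x$, or contains $f\neq a$ for some equation $f=a$ of $\mathcal{F}$, or contains $0\neq 0$. A Delayer strategy guarantees selection of $h$ branching points if in every play consistent with it (against any Prover) at least $h$ branching points are declared before the game ends. -}

module Defs where

open import Data.Nat using (ℕ; zero; suc; _+_; _*_; _∸_; NonZero; _≤_)
open import Data.Nat.DivMod using (_mod_)
open import Data.Fin using (Fin; toℕ)
open import Data.Vec using (Vec; []; _∷_; zipWith; replicate; map)
open import Data.Bool using (Bool; true; false)
open import Data.List using (List; []; _∷_)
open import Data.List.Membership.Propositional using (_∈_)
open import Data.List.Relation.Unary.All using (All)
open import Data.Product using (_×_; _,_; ∃; Σ)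
open import Data.Sum using (_⊎_)
open import Data.Unit using (⊤)
open import Relation.Binary.PropositionalEquality using (_≡_; _≢_)
open import Relation.Nullary using (¬_)

module _ (p : ℕ) .{{_ : NonZero p}} where

  Fp : Set
  Fp = Fin p

  infixl 6 _+F_
  infixl 7 _*F_

  _+F_ : Fp → Fp → Fp
  a +F b = (toℕ a + toℕ b) mod p

  _*F_ : Fp → Fp → Fp
  a *F b = (toℕ a * toℕ b) mod p

  -F_ : Fp → Fp
  -F a = (p ∸ toℕ a) mod p

  0F : Fp
  0F = 0 mod p

  1F : Fp
  1F = 1 mod p

  module _ (n : ℕ) where

    LinForm : Set
    LinForm = Vec Fp n

    record LinPoly : Set where
      constructor poly
      field
        coeffs : Vec Fp n
        const  : Fp
    open LinPoly public

    Equation : Set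
    Equation = LinForm × Fp

    System : Set
    System = List Equation

    evalF : ∀ {m} → Vec Fp m → Vec Fp m → Fp
    evalF []       []       = 0F
    evalF (c ∷ cs) (x ∷ xs) = c *F x +F evalF cs xs

    bool→F : Bool → Fp
    bool→F true  = 1F
    bool→F false = 0F

    boolAssign : Vec Bool n → Vec Fp n
    boolAssign = map bool→F

    Satisfies : Vec Fp n → Equation → Set
    Satisfies x (f , a) = evalF f x ≡ a

    HasSolution : System → Set
    HasSolution H = ∃ λ (x : Vec Fp n) → All (Satisfies x) H

    HasBoolSolution : System → Set
    HasBoolSolution H = ∃ λ (b : Vec Bool n) → All (Satisfies (boolAssign b)) H

    Values : LinForm → Fp → Set
    Values f a = ∃ λ (b : Vec Bool n) → evalF f (boolAssign b) ≡ a

    _+P_ : LinPoly → LinPoly → LinPoly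
    poly c a +P poly d b = poly (zipWith _+F_ c d) (a +F b)

    constP : Fp → LinPoly
    constP a = poly (replicate n 0F) a

    negP : LinPoly → LinPoly
    negP (poly c a) = poly (map -F_ c) (-F a)

    _-P_ : LinPoly → LinPoly → LinPoly
    P -P Q = P +P negP Q

    formP : LinForm → LinPoly
    formP f = poly f 0F

    varP : Fin n → LinPoly
    varP i = poly (Data.Vec.updateAt (replicate n 0F) i (λ _ → 1F)) 0F

    -- Delayer's answer to the linear form f (legality built in)
    data LTResponse (f : LinForm) : Set where
      fix    : (a : Fp) → Values f a → LTResponse f
      branch : (a₁ a₂ : Fp) → a₁ ≢ a₂ → Values f a₁ → Values f a₂ → LTResponse f

    isBranchLT : ∀ {f} → LTResponse f → Bool
    isBranchLT (fix _ _)            = false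
    isBranchLT (branch _ _ _ _ _)   = true

    -- a round from Prover's side: the chosen form, and Prover's choice
    -- (true = first value a₁, false = a₂) used if Delayer branches
    LTProverMove : Set
    LTProverMove = LinForm × Bool

    -- history of Prover moves, most recent first
    LTHistory : Set
    LTHistory = List LTProverMove

    LTStrategy : Set
    LTStrategy = LTHistory → (f : LinForm) → LTResponse f

    ltAdded : ∀ {f} → LTResponse f → Bool → Equation
    ltAdded {f} (fix a _)               _     = f , a
    ltAdded {f} (branch a₁ a₂ _ _ _)    true  = f , a₁
    ltAdded {f} (branch a₁ a₂ _ _ _)    false = f , a₂

    ltPosition : System → LTStrategy → LTHistory → System
    ltPosition F σ []             = F
    ltPosition F σ ((f , b) ∷ hs) = ltAdded (σ hs f) b ∷ ltPosition F σ hs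

    ltBranches : LTStrategy → LTHistory → ℕ
    ltBranches σ []             = 0
    ltBranches σ ((f , b) ∷ hs) with isBranchLT (σ hs f)
    ... | true  = suc (ltBranches σ hs)
    ... | false = ltBranches σ hs

    LTOngoing : System → LTStrategy → LTHistory → Set
    LTOngoing F σ []       = ⊤
    LTOngoing F σ (m ∷ hs) = LTOngoing F σ hs × HasSolution (ltPosition F σ hs)

    LTCompletePlay : System → LTStrategy → LTHistory → Set
    LTCompletePlay F σ hs = LTOngoing F σ hs × ¬ HasSolution (ltPosition F σ hs)

    LTGuarantees : System → LTStrategy → ℕ → Set
    LTGuarantees F σ h =
      ∀ (hs : LTHistory) → LTCompletePlay F σ hs → h ≤ ltBranches σ hs

    -- an inequality  h ≠ c
    Ineq : Set
    Ineq = LinPoly × Fp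

    ineqP : Ineq → LinPoly
    ineqP (h , c) = h -P constP c

    -- Prover's proposal: (h ≠ c , f ≠ a , g ≠ b)
    ResProposal : Set
    ResProposal = Ineq × Ineq × Ineq

    -- a round from Prover's side: proposal and Prover's choice
    -- (true = f ≠ a, false = g ≠ b) used if Delayer branches
    ResProverMove : Set
    ResProverMove = ResProposal × Bool

    data ResResponse : Set where
      left right branch : ResResponse

    ResHistory : Set
    ResHistory = List ResProverMove

    ResStrategy : Set
    ResStrategy = ResHistory → ResProposal → ResResponse

    resAdded : ResProposal → ResResponse → Bool → Ineq
    resAdded (_ , fa , gb) left   _     = fa
    resAdded (_ , fa , gb) right  _     = gb
    resAdded (_ , fa , gb) branch true  = fa
    resAdded (_ , fa , gb) branch false = gb

    isBranchRes : ResResponse → Bool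
    isBranchRes branch = true
    isBranchRes left   = false
    isBranchRes right  = false

    InPos : ResStrategy → ResHistory → Ineq → Set
    InPos τ []               ι = ∃ λ (a : Fp) → a ≢ 0F × ι ≡ (constP 0F , a)
    InPos τ ((q , b) ∷ hs)   ι = ι ≡ resAdded q (τ hs q) b ⊎ InPos τ hs ι

    LegalProposal : ResStrategy → ResHistory → ResProposal → Set
    LegalProposal τ hs (hc , fa , gb) =
      InPos τ hs hc × (ineqP fa +P ineqP gb ≡ ineqP hc)

    -- ending condition (inequalities compared via their polynomials h - c)
    ResEnded : System → ResStrategy → ResHistory → Set
    ResEnded F τ hs =
        (∃ λ (i : Fin n) →
            (∃ λ ι → InPos τ hs ι × ineqP ι ≡ varP i)
          × (∃ λ ι → InPos τ hs ι × ineqP ι ≡ varP i -P constP 1F))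
      ⊎ (∃ λ (e : Equation) → e ∈ F ×
            ∃ λ ι → InPos τ hs ι × ineqP ι ≡ formP (Data.Product.proj₁ e) -P constP (Data.Product.proj₂ e))
      ⊎ (∃ λ ι → InPos τ hs ι × ineqP ι ≡ constP 0F)

    resBranches : ResStrategy → ResHistory → ℕ
    resBranches τ []             = 0
    resBranches τ ((q , b) ∷ hs) with isBranchRes (τ hs q)
    ... | true  = suc (resBranches τ hs)
    ... | false = resBranches τ hs

    ResOngoing : System → ResStrategy → ResHistory → Set
    ResOngoing F τ []             = ⊤
    ResOngoing F τ ((q , b) ∷ hs) =
      ResOngoing F τ hs × ¬ ResEnded F τ hs × LegalProposal τ hs q

    ResCompletePlay : System → ResStrategy → ResHistory → Set
    ResCompletePlay F τ hs = ResOngoing F τ hs × ResEnded F τ hs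

    ResGuarantees : System → ResStrategy → ℕ → Set
    ResGuarantees F τ h =
      ∀ (hs : ResHistory) → ResCompletePlay F τ hs → h ≤ resBranches τ hs

{-# OPTIONS --safe #-}

-- While playing the Res(lin) game, Delayer simulates a play of the LinTrees
-- game, keeping every inequality of the Res(lin) position equal to a nonzero
-- constant on the solution set of the LinTrees position.  When Prover splits P
-- into Q + R, the linear part of Q is queried in LinTrees: a fixed value makes Q
-- and R constant, and one of the constants is nonzero; two distinct values can be
-- matched with Q and R so that each matched polynomial is a nonzero constant.
-- If some variable no longer takes a Boolean value on the solution set, the
-- LinTrees strategy is only good for one more branching point.  At that moment
-- the Res(lin) game has not ended, since only one inequality was added, so
-- Delayer can declare this last branching point in the next round.
module Submission where

open import Defs
open import Algebra.Bundles using (AbelianGroup)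
import Algebra.Properties.AbelianGroup as AbelianGroupProperties
import Algebra.Properties.CommutativeSemigroup as CommutativeSemigroupProperties
open import Data.Bool using (Bool; true; false; not; if_then_else_)
open import Data.Empty using (⊥; ⊥-elim)
open import Data.Fin using (Fin; zero; suc; toℕ; _≟_)
open import Data.Fin.Properties using (any?; toℕ-fromℕ<; toℕ-injective; toℕ<n; toℕ≤n)
open import Data.List using ([]; _∷_)
open import Data.List.Relation.Unary.All as All using (All; []; _∷_)
open import Data.Nat using (ℕ; zero; suc; _+_; _*_; _∸_; NonZero; _≤_; z≤n; s≤s)
open import Data.Nat.DivMod using (_%_; _mod_; %-distribˡ-+; %-distribˡ-*; m<n⇒m%n≡m; n%n≡0; m*n%n≡0)
open import Data.Nat.Primality using (Prime)
open import Data.Nat.Properties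
  using (+-assoc; +-comm; *-distribʳ-+; *-identityˡ; m+[n∸m]≡n;
         ≤-refl; ≤-trans; ≤-reflexive; m≤n+m; 1+n≢0; +-monoʳ-≤; +-monoˡ-≤; module ≤-Reasoning)
open import Data.Product using (∃; _×_; _,_; proj₁; proj₂)
open import Data.Sum using (_⊎_; inj₁; inj₂)
open import Data.Unit using (tt)
open import Data.Vec using (Vec; []; _∷_; zipWith; replicate; lookup; updateAt)
open import Data.Vec.Properties using (lookup-map; lookup-replicate; map-replicate)
open import Function using (_∘_; id)
open import Relation.Binary.PropositionalEquality
open import Relation.Nullary using (¬_; Dec; yes; no; ¬?; _×-dec_; _⊎-dec_)
open import Relation.Nullary.Decidable using (map′)
open import Relation.Unary using (Decidable)

-- Exhaustive search over the finitely many vectors. Delayer's strategy branches on solvability and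
-- on stuck variables, so both have to be decided constructively.
anyVec? : ∀ {k n} {P : Vec (Fin k) n → Set} → Decidable P → Dec (∃ P)
anyVec? {n = zero}  P? = map′ ([] ,_) (λ { ([] , q) → q }) (P? [])
anyVec? {n = suc n} P? =
  map′ (λ { (a , v , q) → a ∷ v , q }) (λ { (a ∷ v , q) → a , v , q })
       (any? λ a → anyVec? λ v → P? (a ∷ v))

indicator : Bool → ℕ
indicator b = if b then 1 else 0

indicator≤1 : ∀ b → indicator b ≤ 1
indicator≤1 true  = ≤-refl
indicator≤1 false = z≤n

-- Arithmetic of residues modulo `p`.

module _ (p : ℕ) .{{_ : NonZero p}} where

  infixl 6 _⊕_
  infixl 7 _⊗_

  _⊕_ _⊗_ : Fp p → Fp p → Fp p
  _⊕_ = _+F_ p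
  _⊗_ = _*F_ p

  ⊖_ : Fp p → Fp p
  ⊖_ = -F_ p

  toℕ-mod : ∀ m → toℕ (m mod p) ≡ m % p
  toℕ-mod m = toℕ-fromℕ< _

  mod-toℕ : ∀ (a : Fp p) → toℕ a mod p ≡ a
  mod-toℕ a = toℕ-injective (trans (toℕ-mod (toℕ a)) (m<n⇒m%n≡m (toℕ<n a)))

  -- With `mod-*` and `mod-toℕ` this makes `_mod p` a surjective homomorphism from the naturals,
  -- along which the laws below are transported.
  mod-+ : ∀ m n → (m + n) mod p ≡ m mod p ⊕ n mod p
  mod-+ m n = toℕ-injective (begin
    toℕ ((m + n) mod p)                     ≡⟨ toℕ-mod (m + n) ⟩
    (m + n) % p                             ≡⟨ %-distribˡ-+ m n p ⟩
    (m % p + n % p) % p                     ≡⟨ cong₂ (λ s t → (s + t) % p) (toℕ-mod m) (toℕ-mod n) ⟨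
    (toℕ (m mod p) + toℕ (n mod p)) % p     ≡⟨ toℕ-mod _ ⟨
    toℕ (m mod p ⊕ n mod p)                 ∎)
    where open ≡-Reasoning

  mod-* : ∀ m n → (m * n) mod p ≡ (m mod p) ⊗ (n mod p)
  mod-* m n = toℕ-injective (begin
    toℕ ((m * n) mod p)                     ≡⟨ toℕ-mod (m * n) ⟩
    (m * n) % p                             ≡⟨ %-distribˡ-* m n p ⟩
    (m % p * (n % p)) % p                   ≡⟨ cong₂ (λ s t → (s * t) % p) (toℕ-mod m) (toℕ-mod n) ⟨
    (toℕ (m mod p) * toℕ (n mod p)) % p     ≡⟨ toℕ-mod _ ⟨
    toℕ ((m mod p) ⊗ (n mod p))                 ∎)
    where open ≡-Reasoning

  ⊕-comm : ∀ a b → a ⊕ b ≡ b ⊕ a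
  ⊕-comm a b = cong (_mod p) (+-comm (toℕ a) (toℕ b))

  ⊕-assoc : ∀ a b c → (a ⊕ b) ⊕ c ≡ a ⊕ (b ⊕ c)
  ⊕-assoc a b c = begin
    (a ⊕ b) ⊕ c                               ≡⟨ cong (a ⊕ b ⊕_) (mod-toℕ c) ⟨
    (a ⊕ b) ⊕ toℕ c mod p                     ≡⟨ mod-+ (toℕ a + toℕ b) (toℕ c) ⟨
    (toℕ a + toℕ b + toℕ c) mod p             ≡⟨ cong (_mod p) (+-assoc (toℕ a) (toℕ b) (toℕ c)) ⟩
    (toℕ a + (toℕ b + toℕ c)) mod p           ≡⟨ mod-+ (toℕ a) (toℕ b + toℕ c) ⟩
    toℕ a mod p ⊕ (b ⊕ c)                     ≡⟨ cong (_⊕ (b ⊕ c)) (mod-toℕ a) ⟩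
    a ⊕ (b ⊕ c)                               ∎
    where open ≡-Reasoning

  ⊕-identityˡ : ∀ a → 0F p ⊕ a ≡ a
  ⊕-identityˡ a = begin
    0F p ⊕ a              ≡⟨ cong (0F p ⊕_) (mod-toℕ a) ⟨
    0F p ⊕ toℕ a mod p    ≡⟨ mod-+ 0 (toℕ a) ⟨
    toℕ a mod p           ≡⟨ mod-toℕ a ⟩
    a                     ∎
    where open ≡-Reasoning

  toℕ-0F : toℕ (0F p) ≡ 0
  toℕ-0F = trans (toℕ-mod 0) (m*n%n≡0 0 p)

  p-mod : p mod p ≡ 0F p
  p-mod = toℕ-injective (trans (toℕ-mod p) (trans (n%n≡0 p) (sym toℕ-0F)))

  ⊕-inverseʳ : ∀ a → a ⊕ ⊖ a ≡ 0F p
  ⊕-inverseʳ a = begin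
    a ⊕ ⊖ a                        ≡⟨ cong (_⊕ ⊖ a) (mod-toℕ a) ⟨
    toℕ a mod p ⊕ ⊖ a              ≡⟨ mod-+ (toℕ a) (p ∸ toℕ a) ⟨
    (toℕ a + (p ∸ toℕ a)) mod p    ≡⟨ cong (_mod p) (m+[n∸m]≡n (toℕ≤n a)) ⟩
    p mod p                        ≡⟨ p-mod ⟩
    0F p                           ∎
    where open ≡-Reasoning

  ⊕-abelianGroup : AbelianGroup _ _
  ⊕-abelianGroup = record
    { _≈_ = _≡_ ; _∙_ = _⊕_ ; ε = 0F p ; _⁻¹ = ⊖_
    ; isAbelianGroup = record
      { isGroup = record
        { isMonoid = record
          { isSemigroup = record
            { isMagma = record { isEquivalence = isEquivalence ; ∙-cong = cong₂ _⊕_ }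
            ; assoc = ⊕-assoc }
          ; identity = ⊕-identityˡ , λ a → trans (⊕-comm a (0F p)) (⊕-identityˡ a) }
        ; inverse = (λ a → trans (⊕-comm (⊖ a) a) (⊕-inverseʳ a)) , ⊕-inverseʳ
        ; ⁻¹-cong = cong ⊖_ }
      ; comm = ⊕-comm } }

  open AbelianGroup ⊕-abelianGroup using (commutativeSemigroup)
    renaming (identityʳ to ⊕-identityʳ)
  open AbelianGroupProperties ⊕-abelianGroup
    using (∙-cancelʳ; x∙y⁻¹≈ε⇒x≈y; ε⁻¹≈ε; xyx⁻¹≈y; identityʳ-unique; ⁻¹-injective)
  open CommutativeSemigroupProperties commutativeSemigroup using (interchange)

  ⊗-distribʳ-⊕ : ∀ x a b → (a ⊕ b) ⊗ x ≡ a ⊗ x ⊕ b ⊗ x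
  ⊗-distribʳ-⊕ x a b = begin
    (a ⊕ b) ⊗ x                                ≡⟨ cong ((a ⊕ b) ⊗_) (mod-toℕ x) ⟨
    (a ⊕ b) ⊗ (toℕ x mod p)                    ≡⟨ mod-* (toℕ a + toℕ b) (toℕ x) ⟨
    ((toℕ a + toℕ b) * toℕ x) mod p            ≡⟨ cong (_mod p) (*-distribʳ-+ (toℕ x) (toℕ a) (toℕ b)) ⟩
    (toℕ a * toℕ x + toℕ b * toℕ x) mod p      ≡⟨ mod-+ (toℕ a * toℕ x) (toℕ b * toℕ x) ⟩
    a ⊗ x ⊕ b ⊗ x                              ∎
    where open ≡-Reasoning

  ⊗-zeroˡ : ∀ a → 0F p ⊗ a ≡ 0F p
  ⊗-zeroˡ a = trans (cong (0F p ⊗_) (sym (mod-toℕ a))) (sym (mod-* 0 (toℕ a)))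

  ⊗-identityˡ : ∀ a → 1F p ⊗ a ≡ a
  ⊗-identityˡ a = begin
    1F p ⊗ a              ≡⟨ cong (1F p ⊗_) (mod-toℕ a) ⟨
    1F p ⊗ (toℕ a mod p)  ≡⟨ mod-* 1 (toℕ a) ⟨
    (1 * toℕ a) mod p     ≡⟨ cong (_mod p) (*-identityˡ (toℕ a)) ⟩
    toℕ a mod p           ≡⟨ mod-toℕ a ⟩
    a                     ∎
    where open ≡-Reasoning

  1F≢0F : 2 ≤ p → 1F p ≢ 0F p
  1F≢0F 2≤p eq = 1+n≢0 (begin
    1            ≡⟨ m<n⇒m%n≡m {m = 1} 2≤p ⟨
    1 % p        ≡⟨ toℕ-mod 1 ⟨
    toℕ (1F p)   ≡⟨ cong toℕ eq ⟩
    toℕ (0F p)   ≡⟨ toℕ-0F ⟩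
    0            ∎)
    where open ≡-Reasoning

  -- Evaluation of linear forms and polynomials.

  module _ (n : ℕ) where

    evalF-+ : ∀ {m} (c d x : Vec (Fp p) m) →
      evalF p n (zipWith (_+F_ p) c d) x ≡ evalF p n c x ⊕ evalF p n d x
    evalF-+ []      []      []      = sym (⊕-identityˡ _)
    evalF-+ (a ∷ c) (b ∷ d) (y ∷ x) = trans
      (cong₂ _⊕_ (⊗-distribʳ-⊕ y a b) (evalF-+ c d x))
      (interchange (a ⊗ y) (b ⊗ y) (evalF p n c x) (evalF p n d x))

    evalF-0 : ∀ {m} (x : Vec (Fp p) m) → evalF p n (replicate m (0F p)) x ≡ 0F p
    evalF-0 []      = refl
    evalF-0 (y ∷ x) = trans (cong₂ _⊕_ (⊗-zeroˡ y) (evalF-0 x)) (⊕-identityˡ _)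

    evalF-unit : ∀ {m} (i : Fin m) (x : Vec (Fp p) m) →
      evalF p n (updateAt (replicate m (0F p)) i (λ _ → 1F p)) x ≡ lookup x i
    evalF-unit zero    (y ∷ x) = trans (cong₂ _⊕_ (⊗-identityˡ y) (evalF-0 x)) (⊕-identityʳ y)
    evalF-unit (suc i) (y ∷ x) = trans (cong₂ _⊕_ (⊗-zeroˡ y) (evalF-unit i x)) (⊕-identityˡ _)

    evalP : LinPoly p n → Vec (Fp p) n → Fp p
    evalP P x = evalF p n (coeffs P) x ⊕ const P

    evalP-+ : ∀ P Q x → evalP (_+P_ p n P Q) x ≡ evalP P x ⊕ evalP Q x
    evalP-+ (poly c a) (poly d b) x = trans
      (cong (_⊕ (a ⊕ b)) (evalF-+ c d x))
      (interchange (evalF p n c x) (evalF p n d x) a b)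

    evalP-constP : ∀ a x → evalP (constP p n a) x ≡ a
    evalP-constP a x = trans (cong (_⊕ a) (evalF-0 x)) (⊕-identityˡ a)

    negP-constP : ∀ a → negP p n (constP p n a) ≡ constP p n (⊖ a)
    negP-constP a = cong (λ c → poly c (⊖ a))
      (trans (map-replicate ⊖_ (0F p) n) (cong (replicate n) ε⁻¹≈ε))

    evalP-−const : ∀ P a x → evalP (_-P_ p n P (constP p n a)) x ≡ evalP P x ⊕ ⊖ a
    evalP-−const P a x = begin
      evalP (_-P_ p n P (constP p n a)) x            ≡⟨ evalP-+ P (negP p n (constP p n a)) x ⟩
      evalP P x ⊕ evalP (negP p n (constP p n a)) x  ≡⟨ cong (λ Q → evalP P x ⊕ evalP Q x) (negP-constP a) ⟩
      evalP P x ⊕ evalP (constP p n (⊖ a)) x         ≡⟨ cong (evalP P x ⊕_) (evalP-constP (⊖ a) x) ⟩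
      evalP P x ⊕ ⊖ a                                ∎
      where open ≡-Reasoning

    evalP-formP : ∀ f x → evalP (formP p n f) x ≡ evalF p n f x
    evalP-formP f x = ⊕-identityʳ _

    evalP-varP : ∀ i x → evalP (varP p n i) x ≡ lookup x i
    evalP-varP i x = trans (⊕-identityʳ _) (evalF-unit i x)

    varP−1 : Fin n → LinPoly p n
    varP−1 i = _-P_ p n (varP p n i) (constP p n (1F p))

    varForm : Fin n → LinForm p n
    varForm i = coeffs (varP p n i)

    value-varForm : ∀ i a → Values p n (varForm i) a → a ≡ 0F p ⊎ a ≡ 1F p
    value-varForm i a (b , refl) with lookup b i in eq
    ... | true  = inj₂ (trans (evalF-unit i (boolAssign p n b))
                    (trans (lookup-map i (bool→F p n) b) (cong (bool→F p n) eq)))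
    ... | false = inj₁ (trans (evalF-unit i (boolAssign p n b))
                    (trans (lookup-map i (bool→F p n) b) (cong (bool→F p n) eq)))

    -- Solution sets and polynomials constant on them.

    Sat : System p n → Vec (Fp p) n → Set
    Sat H x = All (Satisfies p n x) H

    sat? : ∀ H → Decidable (Sat H)
    sat? H x = All.all? (λ (f , a) → evalF p n f x ≟ a) H

    solvable? : ∀ H → Dec (HasSolution p n H)
    solvable? H = anyVec? (sat? H)

    -- Querying such a variable ends the LinTrees game, because every legal answer is 0 or 1. An
    -- unsolvable system in at least one variable is stuck vacuously.
    Stuck : System p n → Set
    Stuck H = ∃ λ i → ¬ ∃ λ x → Sat H x × (lookup x i ≡ 0F p ⊎ lookup x i ≡ 1F p)

    stuck? : ∀ H → Dec (Stuck H)
    stuck? H = any? λ i → ¬? (anyVec? λ x → sat? H x ×-dec (lookup x i ≟ 0F p ⊎-dec lookup x i ≟ 1F p))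

    -- Constancy is demanded beyond nonvanishing: it lets the value of one summand of a split be
    -- computed from the other, and it gives a variable a single value on the solution set.
    NonzeroConstant : System p n → LinPoly p n → Set
    NonzeroConstant H P = ∃ λ u → u ≢ 0F p × ∀ x → Sat H x → evalP P x ≡ u

    NonzeroConstant-∷ : ∀ {H e P} → NonzeroConstant H P → NonzeroConstant (e ∷ H) P
    NonzeroConstant-∷ (u , u≢0 , eq) = u , u≢0 , λ { x (_ ∷ s) → eq x s }

    value-ltAdded : ∀ {f} (ρ : LTResponse p n f) b →
      ∃ λ a → ltAdded p n ρ b ≡ (f , a) × Values p n f a
    value-ltAdded (fix a v)             _     = a , refl , v
    value-ltAdded (branch a₁ a₂ _ v₁ _) true  = a₁ , refl , v₁
    value-ltAdded (branch a₁ a₂ _ _ v₂) false = a₂ , refl , v₂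

    -- Evaluating both sides at the zero vector would force `⊖ 1F p` to vanish. The lemma excludes
    -- that a single added inequality supplies both halves of a contradictory pair.
    varP≢varP−1 : 2 ≤ p → ∀ i → varP p n i ≢ varP−1 i
    varP≢varP−1 2≤p i eq = 1F≢0F 2≤p (⁻¹-injective (trans
      (identityʳ-unique y (⊖ 1F p) (trans (sym (evalP-−const (varP p n i) (1F p) x)) (cong (λ P → evalP P x) (sym eq))))
      (sym ε⁻¹≈ε)))
      where
        x = replicate n (0F p)
        y = evalP (varP p n i) x

    varP-avoids-0 : ∀ {H i x} → NonzeroConstant H (varP p n i) → Sat H x → lookup x i ≢ 0F p
    varP-avoids-0 {i = i} {x} (u , u≢0 , P≡u) s x≡0 =
      u≢0 (trans (sym (P≡u x s)) (trans (evalP-varP i x) x≡0))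

    varP-avoids-1 : ∀ {H i x} → NonzeroConstant H (varP−1 i) →
      Sat H x → lookup x i ≢ 1F p
    varP-avoids-1 {i = i} {x} (u , u≢0 , P≡u) s x≡1 = u≢0 (begin
      u                                                        ≡⟨ P≡u x s ⟨
      evalP (varP−1 i) x               ≡⟨ evalP-−const (varP p n i) (1F p) x ⟩
      evalP (varP p n i) x ⊕ ⊖ 1F p                            ≡⟨ cong (_⊕ ⊖ 1F p) (trans (evalP-varP i x) x≡1) ⟩
      1F p ⊕ ⊖ 1F p                                            ≡⟨ ⊕-inverseʳ (1F p) ⟩
      0F p                                                     ∎)
      where open ≡-Reasoning

    varP-constant : ∀ {H i x y} → NonzeroConstant H (varP p n i) ⊎ NonzeroConstant H (varP−1 i) →
      Sat H x → Sat H y → lookup x i ≡ lookup y i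
    varP-constant {i = i} {x} {y} (inj₁ (u , _ , P≡u)) s t =
      trans (sym (evalP-varP i x)) (trans (trans (P≡u x s) (sym (P≡u y t))) (evalP-varP i y))
    varP-constant {i = i} {x} {y} (inj₂ (u , _ , P≡u)) s t = ∙-cancelʳ (⊖ 1F p) _ _ (begin
      lookup x i ⊕ ⊖ 1F p              ≡⟨ cong (_⊕ ⊖ 1F p) (evalP-varP i x) ⟨
      evalP (varP p n i) x ⊕ ⊖ 1F p    ≡⟨ evalP-−const (varP p n i) (1F p) x ⟨
      evalP (varP−1 i) x               ≡⟨ trans (P≡u x s) (sym (P≡u y t)) ⟩
      evalP (varP−1 i) y               ≡⟨ evalP-−const (varP p n i) (1F p) y ⟩
      evalP (varP p n i) y ⊕ ⊖ 1F p    ≡⟨ cong (_⊕ ⊖ 1F p) (evalP-varP i y) ⟩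
      lookup y i ⊕ ⊖ 1F p              ∎)
      where open ≡-Reasoning

    -- Coordinate `i` is constant on the solution set, so its value at the one solution `x` rules
    -- out Boolean values at all of them.
    stuck-of-constant : ∀ {H i x} → Sat H x → lookup x i ≢ 0F p → lookup x i ≢ 1F p →
      NonzeroConstant H (varP p n i) ⊎ NonzeroConstant H (varP−1 i) →
      Stuck H
    stuck-of-constant {i = i} s x≢0 x≢1 c = i , λ
      { (y , t , inj₁ y≡0) → x≢0 (trans (varP-constant c s t) y≡0)
      ; (y , t , inj₂ y≡1) → x≢1 (trans (varP-constant c s t) y≡1) }

    -- The two summands of a split after a query to the first.

    module _ {H P Q R} {u} (P≡u : ∀ x → Sat H x → evalP P x ≡ u)
             (split : _+P_ p n Q R ≡ P) (v : Fp p) where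

      first-nonzero : v ⊕ const Q ≢ 0F p → NonzeroConstant ((coeffs Q , v) ∷ H) Q
      first-nonzero w≢0 = v ⊕ const Q , w≢0 , λ { x (e ∷ _) → cong (_⊕ const Q) e }

      -- Fixing the linear part of `Q` at `v` makes `Q` equal to `w`, hence `R`, being `P` minus
      -- `Q`, equal to `u ⊕ ⊖ w`.
      second-nonzero : v ⊕ const Q ≢ u → NonzeroConstant ((coeffs Q , v) ∷ H) R
      second-nonzero w≢u = u ⊕ ⊖ w , (λ e → w≢u (sym (x∙y⁻¹≈ε⇒x≈y u w e))) , λ { x (e ∷ s) → begin
          evalP R x                        ≡⟨ xyx⁻¹≈y w (evalP R x) ⟨
          w ⊕ evalP R x ⊕ ⊖ w              ≡⟨ cong (λ a → a ⊕ const Q ⊕ evalP R x ⊕ ⊖ w) e ⟨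
          evalP Q x ⊕ evalP R x ⊕ ⊖ w      ≡⟨ cong (_⊕ ⊖ w) (evalP-+ Q R x) ⟨
          evalP (_+P_ p n Q R) x ⊕ ⊖ w     ≡⟨ cong (λ S → evalP S x ⊕ ⊖ w) split ⟩
          evalP P x ⊕ ⊖ w                  ≡⟨ cong (_⊕ ⊖ w) (P≡u x s) ⟩
          u ⊕ ⊖ w                          ∎ }
        where
          open ≡-Reasoning
          w = v ⊕ const Q

    -- Delayer's strategy by simulation.

    module _ (F : System p n) (σ : LTStrategy p n) where

      position : LTHistory p n → System p n
      position = ltPosition p n F σ

      cost : ResResponse p n → ℕ
      cost r = indicator (isBranchRes p n r)

      -- Here `w₁` and `w₂` are the values of `Q` under the two answers to a branching query, and
      -- `u` is the value of `P`. Giving the first answer to `Q` and the second to `R` works exactly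
      -- when both become nonzero.
      matching : (w₁ w₂ u : Fp p) → Dec (w₁ ≢ 0F p × w₂ ≢ u)
      matching w₁ w₂ u = ¬? (w₁ ≟ 0F p) ×-dec ¬? (w₂ ≟ u)

      -- If `w₁` is zero, then `w₂`, being distinct, is not, and `w₁` differs from the nonzero `u`.
      -- If `w₂` is `u`, then `w₂` is nonzero and `w₁` differs from `u`.
      swapped : ∀ {w₁ w₂ u} → w₁ ≢ w₂ → u ≢ 0F p → ¬ (w₁ ≢ 0F p × w₂ ≢ u) → w₂ ≢ 0F p × w₁ ≢ u
      swapped {w₁} {w₂} {u} w₁≢w₂ u≢0 ¬m with w₁ ≟ 0F p
      ... | yes w₁≡0 = (λ e → w₁≢w₂ (trans w₁≡0 (sym e))) , λ e → u≢0 (trans (sym e) w₁≡0)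
      ... | no  w₁≢0 with w₂ ≟ u
      ...   | yes w₂≡u = (λ e → u≢0 (trans (sym w₂≡u) e)) , λ e → w₁≢w₂ (trans e (sym w₂≡u))
      ...   | no  w₂≢u = ⊥-elim (¬m (w₁≢0 , w₂≢u))

      -- The second component turns Prover's choice between `Q` and `R` into a choice between the
      -- two values; `not` realises the swapped matching.
      follow : (u : Fp p) (Q : LinPoly p n) → LTResponse p n (coeffs Q) → ResResponse p n × (Bool → Bool)
      follow u Q (fix v _) with v ⊕ const Q ≟ 0F p
      -- A vanishing `Q` leaves `R` equal to the nonzero `u`.
      ... | yes _ = right , id
      ... | no  _ = left  , id
      follow u Q (branch v₁ v₂ _ _ _) with matching (v₁ ⊕ const Q) (v₂ ⊕ const Q) u
      ... | yes _ = branch , id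
      ... | no  _ = branch , not

      -- An arbitrary solution x serves to evaluate the constant polynomial of
      -- the inequality h ≠ c.
      answer : LTHistory p n → ResProposal p n → ResResponse p n × (Bool → LTHistory p n)
      answer lh (hc , fa , gb) with solvable? (position lh) | stuck? (position lh)
      ... | yes (x , _) | no _ =
        let Q = ineqP p n fa
            r , choice = follow (evalP (ineqP p n hc) x) Q (σ lh (coeffs Q))
        in r , λ b → (coeffs Q , choice b) ∷ lh
      ... | _           | _    = branch , λ _ → lh

      -- A strategy sees only the history, so the simulated play is recomputed from it. It stays
      -- frozen once its position is stuck or unsolvable.
      simulate : ResHistory p n → LTHistory p n
      simulate []             = []
      simulate ((q , b) ∷ hs) = proj₂ (answer (simulate hs) q) b

      τ : ResStrategy p n
      τ hs q = proj₁ (answer (simulate hs) q)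

      added : ResProposal p n → ResResponse p n → Bool → LinPoly p n
      added q r b = ineqP p n (resAdded p n q r b)

      resBranches-∷ : ∀ q b hs → resBranches p n τ ((q , b) ∷ hs) ≡ cost (τ hs q) + resBranches p n τ hs
      resBranches-∷ q b hs with isBranchRes p n (τ hs q)
      ... | true  = refl
      ... | false = refl

      ltBranches-∷ : ∀ f b lh → ltBranches p n σ ((f , b) ∷ lh)
        ≡ indicator (isBranchLT p n (σ lh f)) + ltBranches p n σ lh
      ltBranches-∷ f b lh with isBranchLT p n (σ lh f)
      ... | true  = refl
      ... | false = refl

      -- Correctness of one simulated round.

      module _ {H hc fa gb u} (u≢0 : u ≢ 0F p) (P≡u : ∀ x → Sat H x → evalP (ineqP p n hc) x ≡ u)
               (split : _+P_ p n (ineqP p n fa) (ineqP p n gb) ≡ ineqP p n hc) where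

        private Q = ineqP p n fa

        follow-cost : ∀ ρ → indicator (isBranchLT p n ρ) ≡ cost (proj₁ (follow u Q ρ))
        follow-cost (fix v _) with v ⊕ const Q ≟ 0F p
        ... | yes _ = refl
        ... | no  _ = refl
        follow-cost (branch v₁ v₂ _ _ _) with matching (v₁ ⊕ const Q) (v₂ ⊕ const Q) u
        ... | yes _ = refl
        ... | no  _ = refl

        follow-nonzero : ∀ ρ b → let r , choice = follow u Q ρ in
          NonzeroConstant (ltAdded p n ρ (choice b) ∷ H) (added (hc , fa , gb) r b)
        follow-nonzero (fix v _) b with v ⊕ const Q ≟ 0F p
        ... | yes w≡0 = second-nonzero P≡u split v (λ w≡u → u≢0 (trans (sym w≡u) w≡0))
        ... | no  w≢0 = first-nonzero P≡u split v w≢0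
        follow-nonzero (branch v₁ v₂ v₁≢v₂ _ _) b
          with matching (v₁ ⊕ const Q) (v₂ ⊕ const Q) u
        follow-nonzero (branch v₁ v₂ v₁≢v₂ _ _) true  | yes (w₁≢0 , _) = first-nonzero P≡u split v₁ w₁≢0
        follow-nonzero (branch v₁ v₂ v₁≢v₂ _ _) false | yes (_ , w₂≢u) = second-nonzero P≡u split v₂ w₂≢u
        follow-nonzero (branch v₁ v₂ v₁≢v₂ _ _) b     | no ¬m
          -- Adding the constant term of `Q` keeps the two distinct values of its linear part
          -- distinct.
          with b | swapped (v₁≢v₂ ∘ ∙-cancelʳ (const Q) v₁ v₂) u≢0 ¬m
        ... | true  | w₂≢0 , _ = first-nonzero P≡u split v₂ w₂≢0
        ... | false | _ , w₁≢u = second-nonzero P≡u split v₁ w₁≢u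

      -- This supplies the last branching point, which the simulated play does not provide.
      answer-stuck : ∀ lh q → Stuck (position lh) → proj₁ (answer lh q) ≡ branch
      answer-stuck lh q st with solvable? (position lh) | stuck? (position lh)
      ... | yes _ | yes _  = refl
      ... | yes _ | no ¬st = ⊥-elim (¬st st)
      ... | no _  | _      = refl

      answer-unstuck : ∀ lh hc fa gb b → HasSolution p n (position lh) → ¬ Stuck (position lh) →
        NonzeroConstant (position lh) (ineqP p n hc) →
        _+P_ p n (ineqP p n fa) (ineqP p n gb) ≡ ineqP p n hc →
        let r , next = answer lh (hc , fa , gb) in
        ∃ λ f → ∃ λ c → next b ≡ (f , c) ∷ lh
          × indicator (isBranchLT p n (σ lh f)) ≡ cost r
          × NonzeroConstant (position (next b)) (added (hc , fa , gb) r b)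
      answer-unstuck lh hc fa gb b sol ¬st (u , u≢0 , P≡u) split
        with solvable? (position lh) | stuck? (position lh)
      ... | no ¬sol     | _      = ⊥-elim (¬sol sol)
      ... | yes _       | yes st = ⊥-elim (¬st st)
      ... | yes (x , s) | no _   =
        _ , _ , refl , follow-cost {hc = hc} {fa} {gb} v≢0 P≡v split ρ
          , follow-nonzero {hc = hc} {fa} {gb} v≢0 P≡v split ρ b
        where
          ρ = σ lh (coeffs (ineqP p n fa))
          -- `answer` reads the constant off the solution it found, while the hypothesis provides
          -- `u`; the two agree because the polynomial is constant.
          v≢0 : evalP (ineqP p n hc) x ≢ 0F p
          v≢0 e = u≢0 (trans (sym (P≡u x s)) e)
          P≡v : ∀ y → Sat (position lh) y → evalP (ineqP p n hc) y ≡ evalP (ineqP p n hc) x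
          P≡v y t = trans (P≡u y t) (sym (P≡u x s))

      -- The invariant and the ending conditions.

      Invariant : ResHistory p n → LTHistory p n → Set
      Invariant hs lh = ∀ ι → InPos p n τ hs ι → NonzeroConstant (position lh) (ineqP p n ι)

      VariableEnded : ResHistory p n → Set
      VariableEnded hs = ∃ λ i →
          (∃ λ ι → InPos p n τ hs ι × ineqP p n ι ≡ varP p n i)
        × (∃ λ ι → InPos p n τ hs ι × ineqP p n ι ≡ varP−1 i)

      axioms-hold : ∀ lh {x} → Sat (position lh) x → Sat F x
      axioms-hold []             s       = s
      axioms-hold ((f , b) ∷ lh) (_ ∷ s) = axioms-hold lh s

      -- A solution of the simulated position also solves `F`, so the polynomial of an axiom's
      -- inequality vanishes there, as does that of `0 ≠ 0`. The invariant forbids both.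
      variable-ended : ∀ {hs lh} → Invariant hs lh → HasSolution p n (position lh) →
        ResEnded p n F τ hs → VariableEnded hs
      variable-ended inv sol (inj₁ v) = v
      variable-ended {lh = lh} inv (x , s) (inj₂ (inj₁ ((f , a) , e∈F , ι , ι∈ , eq))) with inv ι ι∈
      ... | u , u≢0 , P≡u = ⊥-elim (u≢0 (begin
        u                                            ≡⟨ P≡u x s ⟨
        evalP (ineqP p n ι) x                        ≡⟨ cong (λ P → evalP P x) eq ⟩
        evalP (_-P_ p n (formP p n f) (constP p n a)) x  ≡⟨ evalP-−const (formP p n f) a x ⟩
        evalP (formP p n f) x ⊕ ⊖ a                  ≡⟨ cong (_⊕ ⊖ a) (evalP-formP f x) ⟩
        evalF p n f x ⊕ ⊖ a                          ≡⟨ cong (_⊕ ⊖ a) (All.lookup (axioms-hold lh s) e∈F) ⟩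
        a ⊕ ⊖ a                                      ≡⟨ ⊕-inverseʳ a ⟩
        0F p                                         ∎))
        where open ≡-Reasoning
      variable-ended inv (x , s) (inj₂ (inj₂ (ι , ι∈ , eq))) with inv ι ι∈
      ... | u , u≢0 , P≡u = ⊥-elim (u≢0
        (trans (sym (P≡u x s)) (trans (cong (λ P → evalP P x) eq) (evalP-constP (0F p) x))))

      -- The two inequalities give the variable one constant value that is neither 0 nor 1.
      variable-ended⇒stuck : ∀ {hs lh} → Invariant hs lh → HasSolution p n (position lh) →
        VariableEnded hs → Stuck (position lh)
      variable-ended⇒stuck {lh = lh} inv (x , s) (i , (ι₀ , ι₀∈ , eq₀) , (ι₁ , ι₁∈ , eq₁)) =
        stuck-of-constant s (varP-avoids-0 c₀ s) (varP-avoids-1 c₁ s) (inj₁ c₀)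
        where
          c₀ = subst (NonzeroConstant (position lh)) eq₀ (inv ι₀ ι₀∈)
          c₁ = subst (NonzeroConstant (position lh)) eq₁ (inv ι₁ ι₁∈)

      initial-invariant : ∀ {H} ι → InPos p n τ [] ι → NonzeroConstant H (ineqP p n ι)
      initial-invariant _ (a , a≢0 , refl) = 0F p ⊕ ⊖ a
        , (λ e → a≢0 (sym (x∙y⁻¹≈ε⇒x≈y (0F p) a e)))
        , λ x _ → trans (evalP-−const (constP p n (0F p)) a x) (cong (_⊕ ⊖ a) (evalP-constP (0F p) x))

      -- The initial inequalities are nonzero constants on the whole space, whereas a variable
      -- vanishes at the zero vector. Working over the empty system makes that vector a solution
      -- whatever `F` is.
      ¬variable-ended-initially : ¬ VariableEnded []
      ¬variable-ended-initially (i , (ι , ι∈ , eq) , _) =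
        varP-avoids-0 {[]} {x = replicate n (0F p)}
          (subst (NonzeroConstant []) eq (initial-invariant ι ι∈)) [] (lookup-replicate i (0F p))

      -- The variable takes a single value on the solutions of the enlarged system,
      -- and one of the two inequalities was already in the position, so this is
      -- its value on all solutions of the old system.
      ¬variable-ended-∷ : 2 ≤ p → ∀ {m hs e lh x} → Invariant hs lh → ¬ Stuck (position lh) →
        (∀ ι → InPos p n τ (m ∷ hs) ι → NonzeroConstant (e ∷ position lh) (ineqP p n ι)) →
        Sat (e ∷ position lh) x → ¬ VariableEnded (m ∷ hs)
      ¬variable-ended-∷ 2≤p {m} {hs} {e} {lh} inv ¬st inv′ (eq ∷ s) (i , (ι₀ , ι₀∈ , eq₀) , (ι₁ , ι₁∈ , eq₁)) =
        old ι₀∈ ι₁∈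
        where
          H = position lh
          stuck : NonzeroConstant H (varP p n i) ⊎ NonzeroConstant H (varP−1 i) → ⊥
          stuck c = ¬st (stuck-of-constant s
            (varP-avoids-0 (subst (NonzeroConstant (e ∷ H)) eq₀ (inv′ ι₀ ι₀∈)) (eq ∷ s))
            (varP-avoids-1 (subst (NonzeroConstant (e ∷ H)) eq₁ (inv′ ι₁ ι₁∈)) (eq ∷ s)) c)
          old : InPos p n τ (m ∷ hs) ι₀ → InPos p n τ (m ∷ hs) ι₁ → ⊥
          old (inj₂ ι₀∈hs) _             = stuck (inj₁ (subst (NonzeroConstant H) eq₀ (inv ι₀ ι₀∈hs)))
          old (inj₁ _)     (inj₂ ι₁∈hs)  = stuck (inj₂ (subst (NonzeroConstant H) eq₁ (inv ι₁ ι₁∈hs)))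
          old (inj₁ refl)  (inj₁ refl)   = varP≢varP−1 2≤p i (trans (sym eq₀) eq₁)

      -- Counting branching points.

      module _ (2≤p : 2 ≤ p) {h : ℕ} (guaranteed : LTGuarantees p n F σ h) where

        -- Querying the stuck variable completes the LinTrees play, whichever value is added, and
        -- this last round contributes at most one branching point.
        stuck-bound : ∀ lh → LTOngoing p n F σ lh → HasSolution p n (position lh) →
          Stuck (position lh) → h ≤ suc (ltBranches p n σ lh)
        stuck-bound lh ongoing sol (i , never) = begin
          h                                                            ≤⟨ guaranteed ((f , true) ∷ lh) ((ongoing , sol) , unsolvable) ⟩
          ltBranches p n σ ((f , true) ∷ lh)                           ≡⟨ ltBranches-∷ f true lh ⟩
          indicator (isBranchLT p n (σ lh f)) + ltBranches p n σ lh    ≤⟨ +-monoˡ-≤ _ (indicator≤1 (isBranchLT p n (σ lh f))) ⟩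
          suc (ltBranches p n σ lh)                                    ∎
          where
            open ≤-Reasoning
            f = varForm i
            unsolvable : ¬ HasSolution p n (position ((f , true) ∷ lh))
            unsolvable (x , e ∷ s) with value-ltAdded (σ lh f) true
            ... | a , added≡ , v with subst (Satisfies p n x) added≡ e | value-varForm i a v
            ...   | refl | inj₁ a≡0 = never (x , s , inj₁ (trans (sym (evalF-unit i x)) a≡0))
            ...   | refl | inj₂ a≡1 = never (x , s , inj₂ (trans (sym (evalF-unit i x)) a≡1))

        -- The `one-short` phase records that the game has not ended: a further round must come, and
        -- `answer` branches in it.
        data Status (hs : ResHistory p n) : Set where
          won       : h ≤ resBranches p n τ hs → Status hs
          one-short : Stuck (position (simulate hs)) → h ≤ suc (resBranches p n τ hs) →
                      ¬ ResEnded p n F τ hs → Status hs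
          live      : LTOngoing p n F σ (simulate hs) → HasSolution p n (position (simulate hs)) →
                      ¬ Stuck (position (simulate hs)) → Invariant hs (simulate hs) →
                      ltBranches p n σ (simulate hs) ≤ resBranches p n τ hs → Status hs

        -- An unsolvable simulated position completes a LinTrees play, so the guarantee on `σ`
        -- applies; a stuck one is within one branching point by `stuck-bound`.
        classify : ∀ hs → LTOngoing p n F σ (simulate hs) → Invariant hs (simulate hs) →
          ltBranches p n σ (simulate hs) ≤ resBranches p n τ hs →
          (HasSolution p n (position (simulate hs)) → ¬ VariableEnded hs) → Status hs
        classify hs ongoing inv b≤ ¬ended
          with solvable? (position (simulate hs)) | stuck? (position (simulate hs))
        ... | no ¬sol | _      = won (≤-trans (guaranteed _ (ongoing , ¬sol)) b≤)
        ... | yes sol | yes st = one-short st (≤-trans (stuck-bound _ ongoing sol st) (s≤s b≤))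
                                   (¬ended sol ∘ variable-ended {lh = simulate hs} inv sol)
        ... | yes sol | no ¬st = live ongoing sol ¬st inv b≤

        advance : ∀ q b hs → Status hs → LegalProposal p n τ hs q → Status ((q , b) ∷ hs)
        advance q b hs (won h≤) _ =
          won (≤-trans h≤ (≤-trans (m≤n+m _ _) (≤-reflexive (sym (resBranches-∷ q b hs)))))
        -- The forced branching of this round makes up the missing unit.
        advance q b hs (one-short st h≤ _) _ = won (≤-trans h≤ (≤-reflexive (sym
          (trans (resBranches-∷ q b hs) (cong (λ r → cost r + _) (answer-stuck (simulate hs) q st))))))
        advance q@(hc , fa , gb) b hs (live ongoing sol ¬st inv b≤) (hc∈ , split)
          with answer-unstuck (simulate hs) hc fa gb b sol ¬st (inv hc hc∈) split
        ... | f , c , next≡ , cost≡ , new = classify ((q , b) ∷ hs)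
            (subst (LTOngoing p n F σ) (sym next≡) (ongoing , sol))
            (subst (Invariant ((q , b) ∷ hs)) (sym next≡) inv′)
            (begin
              ltBranches p n σ (simulate ((q , b) ∷ hs))                 ≡⟨ cong (ltBranches p n σ) next≡ ⟩
              ltBranches p n σ ((f , c) ∷ simulate hs)                   ≡⟨ ltBranches-∷ f c (simulate hs) ⟩
              indicator (isBranchLT p n (σ (simulate hs) f)) + _         ≡⟨ cong (_+ _) cost≡ ⟩
              cost (τ hs q) + ltBranches p n σ (simulate hs)             ≤⟨ +-monoʳ-≤ (cost (τ hs q)) b≤ ⟩
              cost (τ hs q) + resBranches p n τ hs                       ≡⟨ resBranches-∷ q b hs ⟨
              resBranches p n τ ((q , b) ∷ hs)                           ∎)
            -- The position before this round was not stuck, so the one new inequality cannot have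
            -- ended the game.
            (λ (x , s) → ¬variable-ended-∷ 2≤p {lh = simulate hs} inv ¬st inv′
              (subst (λ lh → Sat (position lh) x) next≡ s))
          where
            open ≤-Reasoning
            inv′ : Invariant ((q , b) ∷ hs) ((f , c) ∷ simulate hs)
            inv′ ι (inj₁ refl) = subst (λ lh → NonzeroConstant (position lh) (ineqP p n ι)) next≡ new
            inv′ ι (inj₂ ι∈)   = NonzeroConstant-∷ {P = ineqP p n ι} (inv ι ι∈)

        status : ∀ hs → ResOngoing p n F τ hs → Status hs
        -- `F` may already be unsolvable or stuck over the field, so the start is classified like
        -- any later position.
        status [] _ = classify [] tt (initial-invariant {F}) z≤n (λ _ → ¬variable-ended-initially)
        status ((q , b) ∷ hs) (ongoing , _ , legal) = advance q b hs (status hs ongoing) legal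

        τ-guarantees : ResGuarantees p n F τ h
        τ-guarantees hs (ongoing , ended) with status hs ongoing
        ... | won h≤               = h≤
        ... | one-short _ _ ¬ended = ⊥-elim (¬ended ended)
        -- In the live phase only a variable ending is possible, and it would make the position
        -- stuck.
        ... | live _ sol ¬st inv _ = ⊥-elim (¬st
          (variable-ended⇒stuck {lh = simulate hs} inv sol (variable-ended {lh = simulate hs} inv sol ended)))

theorem3p8 : ∀ (p : ℕ) .{{_ : NonZero p}} → Prime p → 5 ≤ p →
    ∀ (n : ℕ) (F : System p n) → ¬ HasBoolSolution p n F →
    ∀ (h : ℕ) →
    (∃ λ (σ : LTStrategy p n) → LTGuarantees p n F σ h) →
    ∃ λ (τ : ResStrategy p n) → ResGuarantees p n F τ h
theorem3p8 p _ 5≤p n F _ h (σ , guaranteed) =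
  τ p n F σ , τ-guarantees p n F σ (≤-trans (s≤s (s≤s z≤n)) 5≤p) guaranteed
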